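{- Let $p>3$ be a prime. Then $$\sum_{k=0}^{(p-1)/2}\frac{k\binom{2k}k\binom{3k}k}{27^k}\equiv-\Big(\frac p3\Big)\frac{4-3p+2^{p+2}}{54}\pmod{p^2}.$$
   Context: $\big(\frac p3\big)$ is the Legendre symbol. Congruences are in the ring of rationals with denominators prime to $p$. -}

module Defs where

open import Data.Nat as ℕ using (ℕ; zero; suc; _^_; NonZero; _%_)
open import Data.Nat.Combinatorics using (_C_)
open import Data.Nat.Coprimality using (Coprime)
open import Data.Nat.Properties using (m^n≢0)
open import Data.Integer as ℤ using (ℤ; +_; -[1+_])
open import Data.Rational as ℚ using (ℚ; _/_; _-_; _*_; _+_)
open import Data.Product using (∃; _×_)
open import Relation.Binary.PropositionalEquality using (_≡_)

legendre3 : ℕ → ℤ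
legendre3 a with a % 3
... | 0 = + 0
... | 1 = + 1
... | _ = -[1+ 0 ]

-- Congruence modulo m (a natural number) in the ring of rationals whose
-- denominators are prime to p:  a ≡ b (mod m) iff a - b = m · (z / d)
-- (written with denominator suc d) with z an integer and suc d coprime to p.
CongModQ : (p m : ℕ) → ℚ → ℚ → Set
CongModQ p m a b =
  ∃ λ (z : ℤ) → ∃ λ (d : ℕ) →
    Coprime (suc d) p × (a - b ≡ ((+ m) ℤ.* z) / suc d)

term : ℕ → ℚ
term k = (+ (k ℕ.* ((2 ℕ.* k) C k) ℕ.* ((3 ℕ.* k) C k))) / (27 ^ k)
  where instance _ = m^n≢0 27 k

sumTo : ℕ → (ℕ → ℚ) → ℚ
sumTo zero    f = f 0
sumTo (suc n) f = sumTo n f + f (suc n)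

{-# OPTIONS --safe #-}
module Submission where

-- Put f k a = (-1)^k C(a,k) C(a+k,k) and S n a = Σ_{k≤n} f k a.  Since
-- C(2k,k) C(3k,k) / 27^k = f k (-1/3) = f k (-2/3), it is congruent modulo p² to
-- the integer f k a for a natural number a with 3a ≡ -1 or -2 (mod p²).  Such an
-- a has the form m + ep with m = ⌊p/3⌋ and 3e ≡ -1 (mod p).
--
-- Gosper summation of (k - a(a+1)) f k a reduces the sum to S N a with N = (p-1)/2,
-- plus a boundary term.  S satisfies (a+1)(S n a + S n (a+1)) = 2(a+n+1) f n a,
-- and for n = N the right-hand side at a = j + ep, 0 ≤ j < N, is ≡ 2ep (mod p²), so
-- (-1)^m S N (m+ep) ≡ S N (ep) + 2ep Σ_{1≤j≤m} (-1)^j/j, where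
-- S N (ep) ≡ 1 - ep Σ_{1≤k≤N} 1/k.  As p/k ≡ (-1)^(k-1) C(p,k) (mod p²), the two
-- harmonic sums become Σ C(p,2k) = 2^(p-1) and Σ C(p,3j) = (2^p+1)/3.

open import Defs
open import Data.Nat as ℕ using (ℕ; zero; suc; NonZero; _>_; _∸_; _^_; _%_)
import Data.Nat.Properties as ℕ
import Data.Nat.Divisibility as ℕ
import Data.Nat.Coprimality as ℕ
import Data.Nat.DivMod as ℕ
import Data.Nat.Tactic.RingSolver as ℕ
open import Data.Nat.Combinatorics using (_C_; nCk+nC[k+1]≡[n+1]C[k+1]; nCk≡nC[n∸k]; nCn≡1; nC1≡n; k>n⇒nCk≡0)
open import Data.Nat.Primality using (Prime; prime⇒irreducible)
open import Data.Fin.Patterns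
open import Data.Integer as ℤ using (ℤ; +_; -_; _+_; _-_; _*_; 0ℤ; 1ℤ)
import Data.Integer.Properties as ℤ
open import Data.Integer.Properties using (pos-*)
open import Data.Integer.Coprimality using (Coprime; coprime-divisor)
open import Data.Integer.Divisibility.Signed
open import Data.Integer.Tactic.RingSolver using (solve-∀)
open import Data.Rational as ℚ using (ℚ)
import Data.Rational.Properties as ℚ
open import Data.Rational.Unnormalised as ℚᵘ using (mkℚᵘ)
import Data.Rational.Unnormalised.Properties as ℚᵘ
open import Algebra.Properties.AbelianGroup ℚ.+-0-abelianGroup using (⁻¹-∙-comm; ⁻¹-involutive)
open import Data.Product using (_×_; _,_; ∃)
open import Data.Sum using (inj₁; inj₂)
open import Data.Empty using (⊥; ⊥-elim)
open import Relation.Nullary using (Dec; yes; no)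
open import Relation.Binary.PropositionalEquality

-- Binomial coefficients and the integers f n a

-- An equation is derived from known ones by exhibiting its difference as a linear combination of
-- theirs. The ring solver checks this certificate, so recurrences are used without division.
linear₁ : ∀ {X Y L R} c → L ≡ R → X - Y ≡ c * (L - R) → X ≡ Y
linear₁ {X} {Y} {L} {R} c refl eq = ℤ.i-j≡0⇒i≡j X Y (trans eq (vanish c L))
  where
  vanish : ∀ c x → c * (x - x) ≡ 0ℤ
  vanish = solve-∀

linear₂ : ∀ {X Y L R L′ R′} c c′ → L ≡ R → L′ ≡ R′ →
          X - Y ≡ c * (L - R) + c′ * (L′ - R′) → X ≡ Y
linear₂ {X} {Y} {L} {_} {L′} c c′ refl refl eq = ℤ.i-j≡0⇒i≡j X Y (trans eq (vanish c c′ L L′))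
  where
  vanish : ∀ c c′ x x′ → c * (x - x) + c′ * (x′ - x′) ≡ 0ℤ
  vanish = solve-∀

linear₃ : ∀ {X Y L R L′ R′ L″ R″} c c′ c″ → L ≡ R → L′ ≡ R′ → L″ ≡ R″ →
          X - Y ≡ c * (L - R) + c′ * (L′ - R′) + c″ * (L″ - R″) → X ≡ Y
linear₃ {X} {Y} {L} {_} {L′} {_} {L″} c c′ c″ refl refl refl eq =
  ℤ.i-j≡0⇒i≡j X Y (trans eq (vanish c c′ c″ L L′ L″))
  where
  vanish : ∀ c c′ c″ x x′ x″ → c * (x - x) + c′ * (x′ - x′) + c″ * (x″ - x″) ≡ 0ℤ
  vanish = solve-∀

-- Kept abstract: otherwise conversion checking unfolds _C_ into its factorial quotient.
abstract
  binom : ℕ → ℕ → ℤ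
  binom n k = + (n C k)

  binom≡C : ∀ n k → binom n k ≡ + (n C k)
  binom≡C n k = refl

  pascal : ∀ n k → binom (suc n) (suc k) ≡ binom n k + binom n (suc k)
  pascal n k = cong +_ (sym (nCk+nC[k+1]≡[n+1]C[k+1] n k))

  binom-zero : ∀ n → binom n 0 ≡ 1ℤ
  binom-zero n = cong +_ (trans (nCk≡nC[n∸k] {0} {n} ℕ.z≤n) (nCn≡1 n))

  binom-one : ∀ n → binom n 1 ≡ + n
  binom-one n = cong +_ (nC1≡n n)

  binom-vanish : ∀ {n k} → n ℕ.< k → binom n k ≡ 0ℤ
  binom-vanish n<k = cong +_ (k>n⇒nCk≡0 n<k)

absorb : ∀ n k → + suc k * binom (suc n) (suc k) ≡ + suc n * binom n k
absorb zero zero = trans (cong (1ℤ *_) (binom-one 1)) (sym (cong (1ℤ *_) (binom-zero 0)))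
absorb zero (suc k) = trans
  (trans (cong (+ suc (suc k) *_) (binom-vanish (ℕ.s≤s (ℕ.s≤s ℕ.z≤n)))) (ℤ.*-zeroʳ (+ suc (suc k))))
  (sym (cong (1ℤ *_) (binom-vanish (ℕ.s≤s ℕ.z≤n))))
absorb (suc n) zero = trans (cong (1ℤ *_) (binom-one (suc (suc n))))
  (trans (ℤ.*-comm 1ℤ (+ suc (suc n))) (sym (cong (+ suc (suc n) *_) (binom-zero (suc n)))))
absorb (suc n) (suc k) = trans (cong (+ suc (suc k) *_) (pascal (suc n) (suc k)))
  (trans (expand (+ suc k) (binom (suc n) (suc k)) (binom (suc n) (suc (suc k))))
  (trans (cong₂ (λ u v → u + binom (suc n) (suc k) + v) (absorb n k) (absorb n (suc k)))
  (trans (factor (+ suc n) (binom n k) (binom n (suc k)) (binom (suc n) (suc k)))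
  (trans (cong (λ u → + suc n * u + binom (suc n) (suc k)) (sym (pascal n k)))
         (collect (+ suc n) (binom (suc n) (suc k)))))))
  where
  expand : ∀ c x y → (1ℤ + c) * (x + y) ≡ c * x + x + (1ℤ + c) * y
  expand = solve-∀
  factor : ∀ c u v x → c * u + x + c * v ≡ c * (u + v) + x
  factor = solve-∀
  collect : ∀ c x → c * x + x ≡ (1ℤ + c) * x
  collect = solve-∀

absorb-lower : ∀ n k → + suc k * binom n (suc k) ≡ (+ n - + k) * binom n k
absorb-lower n k = linear₂ 1ℤ (- + suc k) (absorb n k) (pascal n k)
  (id (+ n) (+ k) (binom n k) (binom n (suc k)) (binom (suc n) (suc k)))
  where
  id : ∀ n k x y z → (1ℤ + k) * y - (n - k) * x ≡
    1ℤ * ((1ℤ + k) * z - (1ℤ + n) * x) + - (1ℤ + k) * (z - (x + y))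
  id = solve-∀

absorb-upper : ∀ n k → (+ suc n - + k) * binom (suc n) k ≡ + suc n * binom n k
absorb-upper n k = trans (sym (absorb-lower (suc n) k)) (absorb n k)

abstract
  f : ℕ → ℕ → ℤ
  f n a = (- 1ℤ) ℤ.^ n * (binom a n * binom (a ℕ.+ n) n)

  f-zero : ∀ a → f 0 a ≡ 1ℤ
  f-zero a rewrite binom-zero a | binom-zero (a ℕ.+ 0) = refl

  -- Since (a - n)(a + n + 1) = a(a + 1) - n(n + 1), the ratio of consecutive values depends on `a`
  -- only through a(a + 1).
  f-suc : ∀ n a → + suc n * + suc n * f (suc n) a ≡ - ((+ a - + n) * (+ suc (a ℕ.+ n)) * f n a)
  f-suc n a rewrite ℕ.+-suc a n =
    linear₂ (- (s * (1ℤ + + n) * binom (suc (a ℕ.+ n)) (suc n))) (- (s * (+ a - + n) * binom a n))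
      (absorb-lower a n) (absorb (a ℕ.+ n) n)
      (id s (+ n) (+ a) (binom a n) (binom a (suc n)) (binom (a ℕ.+ n) n) (binom (suc (a ℕ.+ n)) (suc n)))
    where
    s : ℤ
    s = (- 1ℤ) ℤ.^ n
    id : ∀ s n a u u′ v v′ → (1ℤ + n) * (1ℤ + n) * ((- 1ℤ * s) * (u′ * v′)) - - ((a - n) * (1ℤ + (a + n)) * (s * (u * v))) ≡
      - (s * (1ℤ + n) * v′) * ((1ℤ + n) * u′ - (a - n) * u) +
      - (s * (a - n) * u) * ((1ℤ + n) * v′ - (1ℤ + (a + n)) * v)
    id = solve-∀

  f-shift : ∀ n a → (+ suc a - + n) * f n (suc a) ≡ + suc (a ℕ.+ n) * f n a
  f-shift n a =
    linear₂ (s * binom (suc a ℕ.+ n) n) (s * binom a n)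
      (absorb-upper a n)
      (subst (λ x → x * binom (suc a ℕ.+ n) n ≡ + suc (a ℕ.+ n) * binom (a ℕ.+ n) n) (cancel (+ a) (+ n)) (absorb-upper (a ℕ.+ n) n))
      (id s (+ n) (+ a) (binom a n) (binom (suc a) n) (binom (a ℕ.+ n) n) (binom (suc a ℕ.+ n) n))
    where
    s : ℤ
    s = (- 1ℤ) ℤ.^ n
    cancel : ∀ a n → 1ℤ + (a + n) - n ≡ 1ℤ + a
    cancel = solve-∀
    id : ∀ s n a u u′ v v′ → (1ℤ + a - n) * (s * (u′ * v′)) - (1ℤ + (a + n)) * (s * (u * v)) ≡
      (s * v′) * ((1ℤ + a - n) * u′ - (1ℤ + a) * u) +
      (s * u) * ((1ℤ + a) * v′ - (1ℤ + (a + n)) * v)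
    id = solve-∀

-- The factor a + 1 - n that `f-suc` produces at a + 1 is exactly the one that `f-shift` absorbs.
f-suc-shift : ∀ n a → + suc n * + suc n * f (suc n) (suc a) ≡ - ((+ suc (suc (a ℕ.+ n))) * (+ suc (a ℕ.+ n)) * f n a)
f-suc-shift n a = linear₂ 1ℤ (- (+ suc (suc (a ℕ.+ n)))) (f-suc n (suc a)) (f-shift n a)
   (id (+ n) (+ a) (f n a) (f n (suc a)) (f (suc n) (suc a)))
  where
  id : ∀ n a x y z → (1ℤ + n) * (1ℤ + n) * z - - ((1ℤ + (1ℤ + (a + n))) * (1ℤ + (a + n)) * x) ≡
    1ℤ * ((1ℤ + n) * (1ℤ + n) * z - - ((1ℤ + a - n) * (1ℤ + (1ℤ + (a + n))) * y)) +
    - (1ℤ + (1ℤ + (a + n))) * ((1ℤ + a - n) * y - (1ℤ + (a + n)) * x)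
  id = solve-∀

-- Truncated sums of `f` and Gosper summation.

Σ≤ : ℕ → (ℕ → ℤ) → ℤ
Σ≤ zero    g = g 0
Σ≤ (suc n) g = Σ≤ n g + g (suc n)

-- A truncation of the Legendre polynomial value P_a(-1). For n ≥ a the sum is complete and equals
-- (-1)^a, so consecutive `a` cancel; `S-consecutive` measures what truncation leaves over.
S : ℕ → ℕ → ℤ
S n a = Σ≤ n λ k → f k a

*-cancel² : ∀ n {x y} → + suc n * + suc n * x ≡ + suc n * + suc n * y → x ≡ y
*-cancel² n {x} {y} eq = ℤ.*-cancelˡ-≡ (+ suc n * + suc n) x y eq

S-consecutive : ∀ n a → + suc a * (S n a + S n (suc a)) ≡ + 2 * (+ suc (a ℕ.+ n) * f n a)
S-consecutive zero a = linear₂ (+ suc a - + 2 * + suc (a ℕ.+ 0)) (+ suc a) (f-zero a) (f-zero (suc a))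
  (id (+ a) (f 0 a) (f 0 (suc a)))
  where
  id : ∀ a x y → (1ℤ + a) * (x + y) - + 2 * ((1ℤ + (a + 0ℤ)) * x) ≡
    ((1ℤ + a) - + 2 * (1ℤ + (a + 0ℤ))) * (x - 1ℤ) + (1ℤ + a) * (y - 1ℤ)
  id = solve-∀
-- After multiplication by (n+1)², both sides equal 2(a+n+1)((n+1)² - (a+1)²) f n a. The difference
-- of squares is (n - a)(n + a + 2), which `f-suc` turns into f (n+1) a.
S-consecutive (suc n) a = *-cancel² n (trans
  (linear₂ (+ suc n * + suc n) 1ℤ (S-consecutive n a) last-terms
    (id₂ (+ n) (+ a) (f n a) (f (suc n) a) (f (suc n) (suc a)) (S n a) (S n (suc a))))
  (linear₁ (- (+ 2 * + suc (a ℕ.+ suc n))) (f-suc n a)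
    (id₃ (+ n) (+ a) (f n a) (f (suc n) a))))
  where
  id₁ : ∀ n a x y z →
    (1ℤ + n) * (1ℤ + n) * ((1ℤ + a) * (y + z)) - - (+ 2 * (1ℤ + a) * (1ℤ + a) * (1ℤ + (a + n)) * x) ≡
    (1ℤ + a) * ((1ℤ + n) * (1ℤ + n) * y - - ((a - n) * (1ℤ + (a + n)) * x)) +
    (1ℤ + a) * ((1ℤ + n) * (1ℤ + n) * z - - ((1ℤ + (1ℤ + (a + n))) * (1ℤ + (a + n)) * x))
  id₁ = solve-∀
  last-terms : + suc n * + suc n * (+ suc a * (f (suc n) a + f (suc n) (suc a))) ≡
               - (+ 2 * + suc a * + suc a * + suc (a ℕ.+ n) * f n a)
  last-terms = linear₂ (+ suc a) (+ suc a) (f-suc n a) (f-suc-shift n a)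
      (id₁ (+ n) (+ a) (f n a) (f (suc n) a) (f (suc n) (suc a)))
  id₂ : ∀ n a x y z s t →
    (1ℤ + n) * (1ℤ + n) * ((1ℤ + a) * ((s + y) + (t + z))) -
      (+ 2 * (1ℤ + (a + n)) * x * ((1ℤ + n) * (1ℤ + n) - (1ℤ + a) * (1ℤ + a))) ≡
    (1ℤ + n) * (1ℤ + n) * ((1ℤ + a) * (s + t) - + 2 * ((1ℤ + (a + n)) * x)) +
    1ℤ * ((1ℤ + n) * (1ℤ + n) * ((1ℤ + a) * (y + z)) - - (+ 2 * (1ℤ + a) * (1ℤ + a) * (1ℤ + (a + n)) * x))
  id₂ = solve-∀
  id₃ : ∀ n a x y →
    (+ 2 * (1ℤ + (a + n)) * x * ((1ℤ + n) * (1ℤ + n) - (1ℤ + a) * (1ℤ + a))) -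
    (1ℤ + n) * (1ℤ + n) * (+ 2 * ((1ℤ + (a + (1ℤ + n))) * y)) ≡
    - (+ 2 * (1ℤ + (a + (1ℤ + n)))) * ((1ℤ + n) * (1ℤ + n) * y - - ((a - n) * (1ℤ + (a + n)) * x))
  id₃ = solve-∀

-- The antidifference is k² f k a: by `f-suc`, (k+1)² f (k+1) a - k² f k a = (k - a(a+1)) f k a, and
-- the sum telescopes.
Σk-f : ∀ n a → Σ≤ n (λ k → + k * f k a) ≡ + a * + suc a * S n a + + suc n * + suc n * f (suc n) a
Σk-f zero a = linear₁ (- 1ℤ) (f-suc 0 a) (id (+ a) (f 0 a) (f 1 a))
  where
  id : ∀ a x y → 0ℤ * x - (a * (1ℤ + a) * x + 1ℤ * 1ℤ * y) ≡
    - 1ℤ * (1ℤ * 1ℤ * y - - ((a - 0ℤ) * (1ℤ + (a + 0ℤ)) * x))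
  id = solve-∀
Σk-f (suc n) a = linear₂ 1ℤ (- 1ℤ) (Σk-f n a) (f-suc (suc n) a)
  (id (+ a) (+ n) (Σ≤ n (λ k → + k * f k a)) (S n a) (f (suc n) a) (f (suc (suc n)) a))
  where
  id : ∀ a n w s x y →
    (w + (1ℤ + n) * x) - (a * (1ℤ + a) * (s + x) + (+ 2 + n) * (+ 2 + n) * y) ≡
    1ℤ * (w - (a * (1ℤ + a) * s + (1ℤ + n) * (1ℤ + n) * x)) +
    - 1ℤ * ((+ 2 + n) * (+ 2 + n) * y - - ((a - (1ℤ + n)) * (1ℤ + (a + (1ℤ + n))) * x))
  id = solve-∀

-- Binomial sums along arithmetic progressions

abstract
  two^ : ℕ → ℤ
  two^ n = + (2 ℕ.^ n)

  two^≡ : ∀ n → two^ n ≡ + (2 ℕ.^ n)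
  two^≡ n = refl

  two^-zero : two^ 0 ≡ 1ℤ
  two^-zero = refl

  two^-suc : ∀ n → two^ (suc n) ≡ + 2 * two^ n
  two^-suc n = pos-* 2 (2 ℕ.^ n)

-- The cut-off `M` is independent of `n`: the sum is complete once r + M d is large enough, and it
-- can also be grown term by term along a fixed row.
progressionSum : (d r M n : ℕ) → ℤ
progressionSum d r M n = Σ≤ M λ k → binom n (r ℕ.+ k ℕ.* d)

progressionSum-pascal : ∀ d r M n →
  progressionSum d (suc r) M (suc n) ≡ progressionSum d r M n + progressionSum d (suc r) M n
progressionSum-pascal d r zero n = pascal n (r ℕ.+ 0)
progressionSum-pascal d r (suc M) n =
  trans (cong₂ _+_ (progressionSum-pascal d r M n) (pascal n (r ℕ.+ suc M ℕ.* d)))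
        (interchange (progressionSum d r M n) (progressionSum d (suc r) M n) _ _)
  where
  interchange : ∀ a b c d → (a + b) + (c + d) ≡ (a + c) + (b + d)
  interchange = solve-∀

-- Pascal's rule at a multiple of d + 1 brings in the class of d with its index moved down by one.
-- The last term of that class is therefore left over and has to be added on the left.
progressionSum-wrap′ : ∀ d M n →
  progressionSum (suc d) 0 M (suc n) + binom n (d ℕ.+ M ℕ.* suc d) ≡
  progressionSum (suc d) 0 M n + progressionSum (suc d) d M n
progressionSum-wrap′ d zero n =
  cong (_+ binom n (d ℕ.+ 0)) (trans (binom-zero (suc n)) (sym (binom-zero n)))
progressionSum-wrap′ d (suc M) n =
  linear₂ 1ℤ 1ℤ (progressionSum-wrap′ d M n) (pascal n (d ℕ.+ M ℕ.* suc d))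
    (id (progressionSum (suc d) 0 M (suc n)) (binom n (d ℕ.+ M ℕ.* suc d))
        (progressionSum (suc d) 0 M n) (progressionSum (suc d) d M n)
        (binom (suc n) (suc M ℕ.* suc d)) (binom n (suc M ℕ.* suc d))
        (binom n (d ℕ.+ suc M ℕ.* suc d)))
  where
  id : ∀ s b t u x y z → ((s + x) + z) - ((t + y) + (u + z)) ≡
    1ℤ * ((s + b) - (t + u)) + 1ℤ * (x - (b + y))
  id = solve-∀

progressionSum-wrap : ∀ d M n → n ℕ.< d ℕ.+ M ℕ.* suc d →
  progressionSum (suc d) 0 M (suc n) ≡ progressionSum (suc d) 0 M n + progressionSum (suc d) d M n
progressionSum-wrap d M n n< = trans (sym (ℤ.+-identityʳ _))
  (trans (cong (λ x → progressionSum (suc d) 0 M (suc n) + x) (sym (binom-vanish n<))) (progressionSum-wrap′ d M n))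

progressionSum-zero : ∀ d M → progressionSum (suc d) 0 M 0 ≡ 1ℤ
progressionSum-zero d zero = binom-zero 0
progressionSum-zero d (suc M) = cong₂ _+_ (progressionSum-zero d M) (binom-vanish ℕ.z<s)

progressionSum-suc-zero : ∀ d r M → progressionSum d (suc r) M 0 ≡ 0ℤ
progressionSum-suc-zero d r zero = binom-vanish ℕ.z<s
progressionSum-suc-zero d r (suc M) = cong₂ _+_ (progressionSum-suc-zero d r M) (binom-vanish ℕ.z<s)

even-sum : ∀ M n → n ℕ.≤ M ℕ.* 2 → progressionSum 2 0 M (suc n) ≡ two^ n
even-sum M zero _ =
  trans (progressionSum-wrap 1 M 0 ℕ.z<s)
  (trans (cong₂ _+_ (progressionSum-zero 1 M) (progressionSum-suc-zero 2 0 M)) (sym two^-zero))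
even-sum M (suc n) n< =
  trans (progressionSum-wrap 1 M (suc n) (ℕ.s≤s n<))
  -- In row n + 1 the odd sum equals the even sum, as both collect the whole of row n.
  (trans (cong (λ x → progressionSum 2 0 M (suc n) + x)
    (trans (progressionSum-pascal 2 0 M n) (sym (progressionSum-wrap 1 M n (ℕ.≤-trans n< (ℕ.n≤1+n _))))))
  (trans (cong (λ x → x + x) (even-sum M n (ℕ.<⇒≤ n<)))
  (trans (double (two^ n)) (sym (two^-suc n)))))
  where
  double : ∀ x → x + x ≡ + 2 * x
  double = solve-∀

module Thirds (M : ℕ) where
  A₀ A₁ A₂ : ℕ → ℤ
  A₀ = progressionSum 3 0 M
  A₁ = progressionSum 3 1 M
  A₂ = progressionSum 3 2 M

  A₀-suc : ∀ n → n ℕ.< 2 ℕ.+ M ℕ.* 3 → A₀ (suc n) ≡ A₀ n + A₂ n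
  A₀-suc = progressionSum-wrap 2 M
  A₁-suc : ∀ n → A₁ (suc n) ≡ A₀ n + A₁ n
  A₁-suc = progressionSum-pascal 3 0 M
  A₂-suc : ∀ n → A₂ (suc n) ≡ A₁ n + A₂ n
  A₂-suc = progressionSum-pascal 3 1 M

  -- The bound 2 + 3M is the largest lower index occurring in `A₂`, so rows up to it are covered
  -- completely.
  total : ∀ n → n ℕ.≤ 2 ℕ.+ M ℕ.* 3 → A₀ n + A₁ n + A₂ n ≡ two^ n
  total zero _ = trans
    (cong₂ _+_ (cong₂ _+_ (progressionSum-zero 2 M) (progressionSum-suc-zero 3 0 M)) (progressionSum-suc-zero 3 1 M))
    (sym two^-zero)
  total (suc n) n< =
    trans (cong₂ _+_ (cong₂ _+_ (A₀-suc n n<) (A₁-suc n)) (A₂-suc n))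
    (trans (double (A₀ n) (A₁ n) (A₂ n))
    (trans (cong (+ 2 *_) (total n (ℕ.<⇒≤ n<))) (sym (two^-suc n))))
    where
    double : ∀ x y z → (x + z) + (x + y) + (y + z) ≡ + 2 * (x + y + z)
    double = solve-∀

  -- Unfolding A₀ (n+3) twice gives the whole of row n + 1, which is 2·2^n, plus A₂ (n+1) = A₁ n +
  -- A₂ n. Adding A₀ n completes the latter to row n.
  A₀-step³ : ∀ n → 3 ℕ.+ n ℕ.≤ 2 ℕ.+ M ℕ.* 3 → A₀ (3 ℕ.+ n) + A₀ n ≡ + 3 * two^ n
  A₀-step³ n 3+n≤ =
    trans (cong (_+ A₀ n) (trans (A₀-suc (2 ℕ.+ n) 3+n≤)
      (cong₂ _+_ (A₀-suc (1 ℕ.+ n) 2+n≤) (A₂-suc (1 ℕ.+ n)))))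
    (trans (regroup (A₀ (1 ℕ.+ n)) (A₁ (1 ℕ.+ n)) (A₂ (1 ℕ.+ n)) (A₀ n))
    (trans (cong₂ (λ x y → x + y + A₀ n) (trans (total (suc n) (ℕ.<⇒≤ 2+n≤)) (two^-suc n)) (A₂-suc n))
    (trans (regroup′ (two^ n) (A₀ n) (A₁ n) (A₂ n))
    (trans (cong (λ x → + 2 * two^ n + x) (total n (ℕ.<⇒≤ (ℕ.<⇒≤ 2+n≤)))) (triple (two^ n))))))
    where
    2+n≤ : 2 ℕ.+ n ℕ.≤ 2 ℕ.+ M ℕ.* 3
    2+n≤ = ℕ.<⇒≤ 3+n≤
    regroup : ∀ x y z w → (x + z) + (y + z) + w ≡ (x + y + z) + z + w
    regroup = solve-∀
    regroup′ : ∀ t x y z → + 2 * t + (y + z) + x ≡ + 2 * t + (x + y + z)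
    regroup′ = solve-∀
    triple : ∀ t → + 2 * t + t ≡ + 3 * t
    triple = solve-∀

  -- For complete rows this is (1 + ω)^n + (1 + ω²)^n with ω a primitive cube root of unity. As 1 +
  -- ω is a primitive sixth root of unity, three steps change the sign and six restore the value.
  defect : ℕ → ℤ
  defect n = + 3 * A₀ n - two^ n

  defect-step³ : ∀ n → 3 ℕ.+ n ℕ.≤ 2 ℕ.+ M ℕ.* 3 → defect (3 ℕ.+ n) ≡ - defect n
  defect-step³ n 3+n≤ = linear₂ (+ 3) (- 1ℤ) (A₀-step³ n 3+n≤)
    (trans (two^-suc (2 ℕ.+ n)) (cong (+ 2 *_) (trans (two^-suc (suc n)) (cong (+ 2 *_) (two^-suc n)))))
    (id (A₀ (3 ℕ.+ n)) (A₀ n) (two^ (3 ℕ.+ n)) (two^ n))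
    where
    id : ∀ x y s t → (+ 3 * x - s) - - (+ 3 * y - t) ≡
      + 3 * ((x + y) - + 3 * t) + - 1ℤ * (s - + 2 * (+ 2 * (+ 2 * t)))
    id = solve-∀

  defect-step⁶ : ∀ n → 6 ℕ.+ n ℕ.≤ 2 ℕ.+ M ℕ.* 3 → defect (6 ℕ.+ n) ≡ defect n
  defect-step⁶ n 6+n≤ = trans (defect-step³ (3 ℕ.+ n) 6+n≤)
    (trans (cong -_ (defect-step³ n (ℕ.≤-trans (ℕ.m≤n+m (3 ℕ.+ n) 3) 6+n≤))) (ℤ.neg-involutive (defect n)))

  defect-periodic : ∀ r q → r ℕ.+ q ℕ.* 6 ℕ.≤ 2 ℕ.+ M ℕ.* 3 → defect (r ℕ.+ q ℕ.* 6) ≡ defect r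
  defect-periodic r zero _ = cong defect (ℕ.+-identityʳ r)
  defect-periodic r (suc q) le = trans (cong defect shift)
    (trans (defect-step⁶ (r ℕ.+ q ℕ.* 6) le′)
      (defect-periodic r q (ℕ.≤-trans (ℕ.m≤n+m _ 6) le′)))
    where
    shift : r ℕ.+ (6 ℕ.+ q ℕ.* 6) ≡ 6 ℕ.+ (r ℕ.+ q ℕ.* 6)
    shift = trans (sym (ℕ.+-assoc r 6 (q ℕ.* 6)))
      (trans (cong (ℕ._+ q ℕ.* 6) (ℕ.+-comm r 6)) (ℕ.+-assoc 6 r (q ℕ.* 6)))
    le′ : 6 ℕ.+ (r ℕ.+ q ℕ.* 6) ℕ.≤ 2 ℕ.+ M ℕ.* 3
    le′ = subst (ℕ._≤ 2 ℕ.+ M ℕ.* 3) shift le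

  A₀-zero : A₀ 0 ≡ 1ℤ
  A₀-zero = progressionSum-zero 2 M
  A₁-zero : A₁ 0 ≡ 0ℤ
  A₁-zero = progressionSum-suc-zero 3 0 M
  A₂-zero : A₂ 0 ≡ 0ℤ
  A₂-zero = progressionSum-suc-zero 3 1 M

  A₀-one : A₀ 1 ≡ 1ℤ
  A₀-one = trans (A₀-suc 0 ℕ.z<s) (cong₂ _+_ A₀-zero A₂-zero)

  A₀-two : A₀ 2 ≡ 1ℤ
  A₀-two = trans (A₀-suc 1 (ℕ.s≤s ℕ.z<s))
    (cong₂ _+_ A₀-one (trans (A₂-suc 0) (cong₂ _+_ A₁-zero A₂-zero)))

  two^-one : two^ 1 ≡ + 2
  two^-one = trans (two^-suc 0) (cong (+ 2 *_) two^-zero)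

  defect-one : defect 1 ≡ 1ℤ
  defect-one = cong₂ (λ x y → + 3 * x - y) A₀-one two^-one

  defect-two : defect 2 ≡ - 1ℤ
  defect-two = cong₂ (λ x y → + 3 * x - y) A₀-two (trans (two^-suc 1) (cong (+ 2 *_) two^-one))

-- For p = 6q + 1 the cut-off 2q is ⌊p/3⌋. The defect is 1 here, and again for p = 6q + 5.
third-sum₁ : ∀ q → + 3 * progressionSum 3 0 (q ℕ.* 2) (1 ℕ.+ q ℕ.* 6) - two^ (1 ℕ.+ q ℕ.* 6) ≡ 1ℤ
third-sum₁ q = trans (defect-periodic 1 q bound) defect-one
  where
  open Thirds (q ℕ.* 2)
  bound : 1 ℕ.+ q ℕ.* 6 ℕ.≤ 2 ℕ.+ q ℕ.* 2 ℕ.* 3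
  bound = ℕ.s≤s (ℕ.≤-trans (ℕ.≤-reflexive (sym (ℕ.*-assoc q 2 3))) (ℕ.n≤1+n _))

third-sum₅ : ∀ q → + 3 * progressionSum 3 0 (1 ℕ.+ q ℕ.* 2) (5 ℕ.+ q ℕ.* 6) - two^ (5 ℕ.+ q ℕ.* 6) ≡ 1ℤ
third-sum₅ q = trans (defect-periodic 5 q bound)
  (trans (defect-step³ 2 (ℕ.m≤m+n 5 (q ℕ.* 2 ℕ.* 3))) (cong -_ defect-two))
  where
  open Thirds (1 ℕ.+ q ℕ.* 2)
  bound : 5 ℕ.+ q ℕ.* 6 ℕ.≤ 2 ℕ.+ (1 ℕ.+ q ℕ.* 2) ℕ.* 3
  bound = ℕ.+-monoʳ-≤ 5 (ℕ.≤-reflexive (sym (ℕ.*-assoc q 2 3)))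

-- Congruences modulo the square of a prime

-- The divisibility counterpart of `linear₁`: congruences are combined linearly, and exact equations
-- enter through `∣-≡`.
∣-combine₁ : ∀ {m x X} c → m ∣ x → X ≡ c * x → m ∣ X
∣-combine₁ {m} c m∣x eq = subst (m ∣_) (sym eq) (∣n⇒∣m*n c m∣x)

∣-combine₂ : ∀ {m x y X} c d → m ∣ x → m ∣ y → X ≡ c * x + d * y → m ∣ X
∣-combine₂ {m} c d m∣x m∣y eq =
  subst (m ∣_) (sym eq) (∣m∣n⇒∣m+n (∣n⇒∣m*n c m∣x) (∣n⇒∣m*n d m∣y))

∣-combine₃ : ∀ {m x y z X} c d e → m ∣ x → m ∣ y → m ∣ z → X ≡ c * x + d * y + e * z → m ∣ X
∣-combine₃ {m} c d e m∣x m∣y m∣z eq =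
  subst (m ∣_) (sym eq) (∣m∣n⇒∣m+n (∣-combine₂ c d m∣x m∣y refl) (∣n⇒∣m*n e m∣z))

∣-combine₄ : ∀ {m x y z w X} b c d e → m ∣ x → m ∣ y → m ∣ z → m ∣ w →
  X ≡ b * x + c * y + d * z + e * w → m ∣ X
∣-combine₄ {m} b c d e m∣x m∣y m∣z m∣w eq =
  subst (m ∣_) (sym eq) (∣m∣n⇒∣m+n (∣-combine₃ b c d m∣x m∣y m∣z refl) (∣n⇒∣m*n e m∣w))

∣-≡ : ∀ {m x y} → x ≡ y → m ∣ x - y
∣-≡ {m} {x} refl = divides 0ℤ (vanish x m)
  where
  vanish : ∀ x m → x - x ≡ 0ℤ * m
  vanish = solve-∀

∣-square : ∀ {m x y} → m ∣ x → m ∣ y → m * m ∣ x * y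
∣-square {m} (divides q refl) (divides r refl) = divides (q * r) (regroup q r m)
  where
  regroup : ∀ q r m → q * m * (r * m) ≡ q * r * (m * m)
  regroup = solve-∀

square∣⇒∣ : ∀ {m x} → m * m ∣ x → m ∣ x
square∣⇒∣ {m} = ∣-trans (∣m⇒∣m*n m ∣-refl)

cancel-unit : ∀ {m c x} → Coprime m c → m ∣ c * x → m ∣ x
cancel-unit {m} {c} {x} m⊥c m∣cx = ∣ᵤ⇒∣ (coprime-divisor m c x m⊥c (∣⇒∣ᵤ m∣cx))

-- One factor of `m` is cancelled at a time: first m divides x = q m, then dividing by m shows that
-- m divides c q. That division needs m to be nonzero, hence the case split.
cancel-unit² : ∀ {m c x} → Coprime m c → m * m ∣ c * x → m * m ∣ x
cancel-unit² {m} {c} {x} m⊥c mm∣cx with cancel-unit {m} {c} m⊥c (square∣⇒∣ mm∣cx)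
... | divides q refl = ∣-square′ (m ℤ.≟ 0ℤ)
  where
  regroup : ∀ c q m → c * (q * m) ≡ m * (c * q)
  regroup = solve-∀
  ∣-square′ : Dec (m ≡ 0ℤ) → m * m ∣ q * m
  ∣-square′ (yes refl) = divides 0ℤ (ℤ.*-zeroʳ q)
  ∣-square′ (no m≢0) = ∣-square {m} {q} {m} (cancel-unit {m} {c} m⊥c
    (*-cancelˡ-∣ m {{ℤ.≢-nonZero m≢0}} (subst (m * m ∣_) (regroup c q m) mm∣cx))) ∣-refl

coprime-cong : ∀ {m c d} → Coprime m d → m ∣ c - d → Coprime m c
coprime-cong {m} {c} {d} m⊥d m∣c-d {g} (g∣m , g∣c) = m⊥d (g∣m , ∣⇒∣ᵤ g∣d)
  where
  id : ∀ c d → d ≡ 1ℤ * c + - 1ℤ * (c - d)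
  id = solve-∀
  g∣d : + g ∣ d
  g∣d = ∣-combine₂ 1ℤ (- 1ℤ) (∣ᵤ⇒∣ {i = c} g∣c) (∣-trans (∣ᵤ⇒∣ {i = m} g∣m) m∣c-d) (id c d)

coprime-neg : ∀ {m c} → Coprime m c → Coprime m (- c)
coprime-neg {m} {c} m⊥c {g} (g∣m , g∣c) = m⊥c (g∣m , subst (g ℕ.∣_) (ℤ.∣-i∣≡∣i∣ c) g∣c)

sgn : ℕ → ℤ
sgn zero    = 1ℤ
sgn (suc n) = - sgn n

sgn² : ∀ n → sgn n * sgn n ≡ 1ℤ
sgn² zero    = refl
sgn² (suc n) = trans (neg² (sgn n)) (sgn² n)
  where
  neg² : ∀ x → - x * - x ≡ x * x
  neg² = solve-∀

sgn-double : ∀ n → sgn (n ℕ.* 2) ≡ 1ℤ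
sgn-double zero = refl
sgn-double (suc n) = trans (ℤ.neg-involutive _) (sgn-double n)

sgn-triple : ∀ n → sgn (n ℕ.* 3) ≡ sgn n
sgn-triple zero = refl
sgn-triple (suc n) = trans (ℤ.neg-involutive _) (cong -_ (sgn-triple n))

module ModPrimeSquare (N : ℕ) (prime : Prime (suc (N ℕ.+ N))) where

  p : ℕ
  p = suc (N ℕ.+ N)

  P : ℤ
  -- Definitionally `+ p`, but spelled out so that ring identities can use p = 2N + 1.
  P = 1ℤ + (+ N + + N)

  unit : ∀ {k} → suc k ℕ.< p → Coprime P (+ suc k)
  unit k<p = ℕ.prime⇒coprime prime k<p

  -- Proved together with `p∣binom`: in (k+2) C(p,k+2) = (p - k - 1) C(p,k+1) the part p C(p,k+1)
  -- vanishes modulo p² because p already divides C(p,k+1). Only a change of sign remains.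
  binom-p : ∀ k → suc k ℕ.< p → P * P ∣ + suc k * binom p (suc k) - sgn k * P
  p∣binom : ∀ k → suc k ℕ.< p → P ∣ binom p (suc k)

  binom-p zero _ = ∣-combine₁ 1ℤ (∣-≡ (binom-one p)) (id P (binom p 1))
    where
    id : ∀ P x → 1ℤ * x - 1ℤ * P ≡ 1ℤ * (x - P)
    id = solve-∀
  binom-p (suc k) k< =
    ∣-combine₃ 1ℤ 1ℤ (- 1ℤ) (∣-≡ (absorb-lower p (suc k))) (∣-square ∣-refl (p∣binom k (ℕ.<⇒≤ k<)))
      (binom-p k (ℕ.<⇒≤ k<))
      (id P (+ k) (binom p (suc k)) (binom p (suc (suc k))) (sgn k))
    where
    id : ∀ P k x y s → (+ 2 + k) * y - - s * P ≡
      1ℤ * ((+ 2 + k) * y - (P - (1ℤ + k)) * x) + 1ℤ * (P * x) + - 1ℤ * ((1ℤ + k) * x - s * P)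
    id = solve-∀
  p∣binom k k< = cancel-unit {P} {+ suc k} (unit k<)
    (∣-combine₂ 1ℤ (sgn k) (square∣⇒∣ (binom-p k k<)) ∣-refl
      (id P (+ suc k * binom p (suc k)) (sgn k)))
    where
    id : ∀ P x s → x ≡ 1ℤ * (x - s * P) + s * P
    id = solve-∀

  -- Values of `f` at and just above a multiple `w` of p.

  module NearZero (w : ℕ) (p∣w : P ∣ + w) where
    W : ℤ
    W = + w

    -- Modulo w the product (w - k)(w + k + 1) is -k(k + 1), so by `f-suc` the quantity k f k w
    -- keeps its initial value -w. The error terms carry w f k w, which p² divides by `p∣f`.
    f-near-zero : ∀ k → suc k ℕ.< p → P * P ∣ + suc k * f (suc k) w + W
    p∣f : ∀ k → suc k ℕ.< p → P ∣ f (suc k) w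

    f-near-zero zero _ = ∣-combine₃ 1ℤ (- 1ℤ) (- (W * (1ℤ + W))) (∣-≡ (f-suc 0 w)) (∣-square p∣w p∣w)
        (∣-≡ (f-zero w)) (id W (f 0 w) (f 1 w))
      where
      id : ∀ W x y → 1ℤ * y + W ≡ 1ℤ * (1ℤ * 1ℤ * y - - ((W - 0ℤ) * (1ℤ + (W + 0ℤ)) * x)) +
        - 1ℤ * (W * W) + - (W * (1ℤ + W)) * (x - 1ℤ)
      id = solve-∀
    f-near-zero (suc k) k< = cancel-unit² {P} {+ suc (suc k)} (unit k<)
      (∣-combine₃ 1ℤ (+ suc (suc k)) (- (W + 1ℤ))
        (∣-≡ (f-suc (suc k) w)) (f-near-zero k (ℕ.<⇒≤ k<)) (∣-square p∣w (p∣f k (ℕ.<⇒≤ k<)))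
        (id W (+ k) (f (suc k) w) (f (suc (suc k)) w)))
      where
      id : ∀ W k x y → (+ 2 + k) * ((+ 2 + k) * y + W) ≡
        1ℤ * ((+ 2 + k) * (+ 2 + k) * y - - ((W - (1ℤ + k)) * (1ℤ + (W + (1ℤ + k))) * x)) +
        (+ 2 + k) * ((1ℤ + k) * x + W) + - (W + 1ℤ) * (W * x)
      id = solve-∀
    p∣f k k< = cancel-unit {P} {+ suc k} (unit k<)
      (∣-combine₂ 1ℤ (- 1ℤ) (square∣⇒∣ (f-near-zero k k<)) p∣w (id (+ suc k * f (suc k) w) W))
      where
      id : ∀ x W → x ≡ 1ℤ * (x + W) + - 1ℤ * W
      id = solve-∀

    -- Half the right-hand side of `S-consecutive` for n = N and a = j + w. It is also a factor of
    -- the boundary term of `Σk-f`.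
    h : ℕ → ℤ
    h j = + suc ((j ℕ.+ w) ℕ.+ N) * f N (j ℕ.+ w)

    N<p : N ℕ.< p
    N<p = ℕ.s≤s (ℕ.m≤m+n N N)

    h-cong-zero : ∀ n → suc n ≡ N → P * P ∣ h 0 - W
    -- Here 1 + w + N = p - N + w, and only -N f N w survives modulo p².
    h-cong-zero n refl = ∣-combine₃ 1ℤ 1ℤ (- 1ℤ)
        (∣-square ∣-refl (p∣f n N<p)) (∣-square p∣w (p∣f n N<p)) (f-near-zero n N<p)
        (id W (+ n) (f (suc n) w))
      where
      id : ∀ W n x → (1ℤ + (W + (1ℤ + n))) * x - W ≡
        1ℤ * ((1ℤ + ((1ℤ + n) + (1ℤ + n))) * x) + 1ℤ * (W * x) + - 1ℤ * ((1ℤ + n) * x + W)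
      id = solve-∀

    j+1+i<p : ∀ {j i} → suc j ℕ.+ suc i ≡ N → suc i ℕ.< p
    j+1+i<p {j} {i} eq = ℕ.≤-trans (ℕ.s≤s (ℕ.m≤n+m (suc i) (suc j))) (ℕ.≤-trans (ℕ.s≤s (ℕ.≤-reflexive eq)) N<p)

    -- This factor is -(i + 1) modulo p. The witness `i` keeps j + 1 below N, so it does not vanish.
    factor-unit : ∀ {j i} → suc j ℕ.+ suc i ≡ N → Coprime P (+ suc (j ℕ.+ w) - + N)
    factor-unit {j} {i} eq = coprime-cong {P} {+ suc (j ℕ.+ w) - + N} { - (+ suc i)}
      (coprime-neg {P} {+ suc i} (unit (j+1+i<p eq)))
      (∣-combine₂ 1ℤ 1ℤ p∣w (∣-≡ (cong +_ eq)) (id (+ j) (+ i) (+ N) W))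
      where
      id : ∀ j i N W → (1ℤ + (j + W)) - N - - (1ℤ + i) ≡ 1ℤ * W + 1ℤ * (((1ℤ + j) + (1ℤ + i)) - N)
      id = solve-∀

    -- With a = j + w, `f-shift` gives (a + 1 - N) h (j+1) = (a + N + 2) h j. The two factors differ
    -- by p and p divides w, so the value w persists modulo p².
    h-cong-suc : ∀ j i → suc j ℕ.+ suc i ≡ N → P * P ∣ h j - W → P * P ∣ h (suc j) - W
    h-cong-suc j i eq ih = cancel-unit² {P} {+ suc (j ℕ.+ w) - + N} (factor-unit eq)
      (∣-combine₃ (+ suc (suc ((j ℕ.+ w) ℕ.+ N))) (+ suc (suc ((j ℕ.+ w) ℕ.+ N))) 1ℤ
        (∣-≡ (f-shift N (j ℕ.+ w))) ih (∣-square p∣w ∣-refl)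
        (id (+ (j ℕ.+ w)) (+ N) W (f N (j ℕ.+ w)) (f N (suc (j ℕ.+ w)))))
      where
      id : ∀ a N W x y → (1ℤ + a - N) * ((1ℤ + ((1ℤ + a) + N)) * y - W) ≡
        (+ 2 + (a + N)) * ((1ℤ + a - N) * y - (1ℤ + (a + N)) * x) +
        (+ 2 + (a + N)) * ((1ℤ + (a + N)) * x - W) + 1ℤ * (W * (1ℤ + (N + N)))
      id = solve-∀

    h-cong : ∀ j i → j ℕ.+ suc i ≡ N → P * P ∣ h j - W
    h-cong zero i eq = h-cong-zero i eq
    h-cong (suc j) i eq = h-cong-suc j i eq (h-cong j (suc i) (trans (ℕ.+-suc j (suc i)) eq))

  binom-even : ∀ k → suc k ℕ.* 2 ℕ.< p → P * P ∣ (+ 2 + + k * + 2) * binom p (suc k ℕ.* 2) + P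
  binom-even k k< = ∣-combine₃ 1ℤ (- binom p (suc k ℕ.* 2)) (- P)
      (binom-p (suc (k ℕ.* 2)) k<) (∣-≡ (pos-* k 2)) (∣-≡ (sgn-double k))
      (id P (+ k) (+ (k ℕ.* 2)) (sgn (k ℕ.* 2)) (binom p (suc k ℕ.* 2)))
    where
    id : ∀ P k k₂ s b → (+ 2 + k * + 2) * b + P ≡
      1ℤ * ((+ 2 + k₂) * b - - s * P) + - b * (k₂ - k * + 2) + - P * (s - 1ℤ)
    id = solve-∀

  -- The sign in `binom-p` is (-1)^(3k+2) = (-1)^k, so the alternating harmonic sum becomes a
  -- binomial sum without signs.
  binom-third : ∀ k → suc k ℕ.* 3 ℕ.< p →
    P * P ∣ (+ 3 + + k * + 3) * (sgn k * binom p (suc k ℕ.* 3)) - P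
  binom-third k k< = ∣-combine₄ (sgn k) (- (sgn k * binom p (suc k ℕ.* 3))) (sgn k * P) P
      (binom-p (2 ℕ.+ k ℕ.* 3) k<) (∣-≡ (pos-* k 3)) (∣-≡ (sgn-triple k)) (∣-≡ (sgn² k))
      (id P (+ k) (+ (k ℕ.* 3)) (sgn k) (sgn (k ℕ.* 3)) (binom p (suc k ℕ.* 3)))
    where
    id : ∀ P k k₃ s s₃ b → (+ 3 + k * + 3) * (s * b) - P ≡
      s * ((+ 3 + k₃) * b - - - s₃ * P) + - (s * b) * (k₃ - k * + 3) + (s * P) * (s₃ - s) + P * (s * s - 1ℤ)
    id = solve-∀

  -- Every term after the first is divisible by p. Together with `even-sum` this yields Fermat's
  -- little theorem for base 2.
  even-sum-cong : ∀ n → n ℕ.* 2 ℕ.< p → P ∣ progressionSum 2 0 n p - 1ℤ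
  even-sum-cong zero _ = ∣-≡ (binom-zero p)
  even-sum-cong (suc n) n< = ∣-combine₂ 1ℤ 1ℤ (even-sum-cong n (ℕ.<⇒≤ (ℕ.<⇒≤ n<))) (p∣binom (suc (n ℕ.* 2)) n<)
      (id (progressionSum 2 0 n p) (binom p (suc n ℕ.* 2)))
    where
    id : ∀ x y → (x + y) - 1ℤ ≡ 1ℤ * (x - 1ℤ) + 1ℤ * y
    id = solve-∀

  -- The sums S N (m + w) modulo p².

  module Sums (w : ℕ) (E : ℤ) (w≡EP : + w ≡ E * P) where
    p∣w : P ∣ + w
    p∣w = divides E w≡EP
    open NearZero w p∣w

    f-binom : ∀ k → suc k ℕ.* 2 ℕ.< p → P * P ∣ f (suc k) w - + 2 * E * binom p (suc k ℕ.* 2)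
    f-binom k k< = cancel-unit² {P} {+ suc k} (unit k+1<p)
      (∣-combine₃ 1ℤ (- 1ℤ) (- E) (f-near-zero k k+1<p) (∣-≡ w≡EP) (binom-even k k<)
        (id P W E (+ k) (f (suc k) w) (binom p (suc k ℕ.* 2))))
      where
      k+1<p : suc k ℕ.< p
      k+1<p = ℕ.≤-<-trans (ℕ.m≤m*n (suc k) 2) k<
      id : ∀ P W E k x b → (1ℤ + k) * (x - + 2 * E * b) ≡
        1ℤ * ((1ℤ + k) * x + W) + - 1ℤ * (W - E * P) + - E * ((+ 2 + k * + 2) * b + P)
      id = solve-∀

    S-near-zero : ∀ n → n ℕ.* 2 ℕ.< p → P * P ∣ S n w - (1ℤ + + 2 * E * (progressionSum 2 0 n p - 1ℤ))
    S-near-zero zero _ = ∣-combine₂ 1ℤ (- (+ 2 * E)) (∣-≡ (f-zero w)) (∣-≡ (binom-zero p)) (id E (f 0 w) (binom p 0))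
      where
      id : ∀ E x b → x - (1ℤ + + 2 * E * (b - 1ℤ)) ≡ 1ℤ * (x - 1ℤ) + - (+ 2 * E) * (b - 1ℤ)
      id = solve-∀
    S-near-zero (suc n) n< = ∣-combine₂ 1ℤ 1ℤ (S-near-zero n (ℕ.<⇒≤ (ℕ.<⇒≤ n<))) (f-binom n n<)
        (id E (S n w) (progressionSum 2 0 n p) (f (suc n) w) (binom p (suc n ℕ.* 2)))
      where
      id : ∀ E s c x b → (s + x) - (1ℤ + + 2 * E * (c + b - 1ℤ)) ≡
        1ℤ * (s - (1ℤ + + 2 * E * (c - 1ℤ))) + 1ℤ * (x - + 2 * E * b)
      id = solve-∀

    S-consecutive-cong : ∀ j i → j ℕ.+ suc i ≡ N →
      P * P ∣ + suc (j ℕ.+ w) * (S N (j ℕ.+ w) + S N (suc (j ℕ.+ w))) - + 2 * W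
    S-consecutive-cong j i eq = ∣-combine₂ 1ℤ (+ 2) (∣-≡ (S-consecutive N (j ℕ.+ w))) (h-cong j i eq)
        (id (+ suc (j ℕ.+ w) * (S N (j ℕ.+ w) + S N (suc (j ℕ.+ w)))) W (h j))
      where
      id : ∀ x W h → x - + 2 * W ≡ 1ℤ * (x - + 2 * h) + + 2 * (h - W)
      id = solve-∀

    -- This makes w times the sum vanish modulo p², so that `S-step` may replace the factor 1 + j +
    -- w by 1 + j.
    p∣S-consecutive : ∀ j i → j ℕ.+ suc i ≡ N → P ∣ S N (j ℕ.+ w) + S N (suc (j ℕ.+ w))
    p∣S-consecutive j i eq = cancel-unit {P} {+ suc (j ℕ.+ w)}
        (coprime-cong {P} {+ suc (j ℕ.+ w)} {+ suc j} (unit j+1<p)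
          (∣-combine₁ 1ℤ p∣w (id₁ (+ j) W)))
        (∣-combine₂ 1ℤ (+ 2) (square∣⇒∣ (S-consecutive-cong j i eq)) p∣w
          (id₂ (+ suc (j ℕ.+ w) * (S N (j ℕ.+ w) + S N (suc (j ℕ.+ w)))) W))
      where
      j+1<p : suc j ℕ.< p
      j+1<p = ℕ.s≤s (ℕ.≤-trans (ℕ.≤-trans (ℕ.m≤m+n (suc j) i) (ℕ.≤-reflexive (trans (sym (ℕ.+-suc j i)) eq))) (ℕ.m≤m+n N N))
      id₁ : ∀ j W → (1ℤ + (j + W)) - (1ℤ + j) ≡ 1ℤ * W
      id₁ = solve-∀
      id₂ : ∀ x W → x ≡ 1ℤ * (x - + 2 * W) + + 2 * W
      id₂ = solve-∀

    S-step : ∀ j i → j ℕ.+ suc i ≡ N → suc j ℕ.* 3 ℕ.< p →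
      P * P ∣ S N (j ℕ.+ w) + S N (suc (j ℕ.+ w)) - + 6 * E * (sgn j * binom p (suc j ℕ.* 3))
    S-step j i eq j< = cancel-unit² {P} {+ suc j} (unit (ℕ.≤-<-trans (ℕ.m≤m*n (suc j) 3) j<))
        (∣-combine₄ 1ℤ (- 1ℤ) (+ 2) (- (+ 2 * E))
          (S-consecutive-cong j i eq) (∣-square p∣w (p∣S-consecutive j i eq)) (∣-≡ w≡EP) (binom-third j j<)
          (id P W E (+ j) (S N (j ℕ.+ w) + S N (suc (j ℕ.+ w))) (sgn j * binom p (suc j ℕ.* 3))))
      where
      id : ∀ P W E j s b → (1ℤ + j) * (s - + 6 * E * b) ≡
        1ℤ * ((1ℤ + (j + W)) * s - + 2 * W) + - 1ℤ * (W * s) + + 2 * (W - E * P) +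
        - (+ 2 * E) * ((+ 3 + j * + 3) * b - P)
      id = solve-∀

    S-alternating : ∀ m i → m ℕ.+ i ≡ N → m ℕ.* 3 ℕ.< p →
      P * P ∣ sgn m * S N (m ℕ.+ w) - (S N w - + 6 * E * (progressionSum 3 0 m p - 1ℤ))
    S-alternating zero _ _ _ = ∣-combine₁ (+ 6 * E) (∣-≡ (binom-zero p)) (id E (S N w) (binom p 0))
      where
      id : ∀ E s b → 1ℤ * s - (s - + 6 * E * (b - 1ℤ)) ≡ + 6 * E * (b - 1ℤ)
      id = solve-∀
    S-alternating (suc m) i eq m< =
        ∣-combine₃ 1ℤ (- sgn m) (- (+ 6 * E * binom p (suc m ℕ.* 3)))
          (S-alternating m (suc i) eq′ (ℕ.<⇒≤ (ℕ.<⇒≤ (ℕ.<⇒≤ m<))))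
          (S-step m i eq′ m<) (∣-≡ (sgn² m))
          (id E (sgn m) (S N w) (S N (m ℕ.+ w)) (S N (suc (m ℕ.+ w))) (progressionSum 3 0 m p) (binom p (suc m ℕ.* 3)))
      where
      eq′ : m ℕ.+ suc i ≡ N
      eq′ = trans (ℕ.+-suc m i) eq
      id : ∀ E σ s₀ s s′ c b → - σ * s′ - (s₀ - + 6 * E * (c + b - 1ℤ)) ≡
        1ℤ * (σ * s - (s₀ - + 6 * E * (c - 1ℤ))) +
        - σ * (s + s′ - + 6 * E * (σ * b)) + - (+ 6 * E * b) * (σ * σ - 1ℤ)
      id = solve-∀

    X : ℤ
    X = two^ (N ℕ.+ N)

    module Third (m i : ℕ) (m<N : m ℕ.+ suc i ≡ N) (3m<p : m ℕ.* 3 ℕ.< p)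
                 (p∣3E+1 : P ∣ + 3 * E + 1ℤ)
                 (third-sum : + 3 * progressionSum 3 0 m p - two^ p ≡ 1ℤ) where
      σ : ℤ
      σ = sgn m
      a : ℕ
      a = m ℕ.+ w

      N*2≡N+N : N ℕ.* 2 ≡ N ℕ.+ N
      N*2≡N+N = trans (ℕ.*-comm N 2) (cong (N ℕ.+_) (ℕ.+-identityʳ N))

      N*2<p : N ℕ.* 2 ℕ.< p
      N*2<p = ℕ.s≤s (ℕ.≤-reflexive N*2≡N+N)

      even-total : progressionSum 2 0 N p ≡ X
      even-total = even-sum N (N ℕ.+ N) (ℕ.≤-reflexive (sym N*2≡N+N))

      p∣X-1 : P ∣ X - 1ℤ
      p∣X-1 = subst (λ x → P ∣ x - 1ℤ) even-total (even-sum-cong N N*2<p)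

      S-zero : P * P ∣ S N w - (1ℤ + + 2 * E * (X - 1ℤ))
      S-zero = subst (λ x → P * P ∣ S N w - (1ℤ + + 2 * E * (x - 1ℤ))) even-total (S-near-zero N N*2<p)

      third-total : + 3 * progressionSum 3 0 m p ≡ 1ℤ + + 2 * X
      third-total = linear₂ 1ℤ 1ℤ third-sum (two^-suc (N ℕ.+ N)) (id (progressionSum 3 0 m p) (two^ p) X)
        where
        id : ∀ A T X → + 3 * A - (1ℤ + + 2 * X) ≡ 1ℤ * (+ 3 * A - T - 1ℤ) + 1ℤ * (T - + 2 * X)
        id = solve-∀

      -- The three inputs give 3 - 6E(X - 1). Since p divides both X - 1 and 3E + 1, the term -6E(X
      -- - 1) is 2(X - 1), and E disappears.
      S-third : P * P ∣ + 3 * (σ * S N a) - (1ℤ + + 2 * X)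
      S-third = ∣-combine₄ (+ 3) (+ 3) (- (+ 6 * E)) (- (+ 2))
          (S-alternating m (suc i) m<N 3m<p) S-zero (∣-≡ third-total) (∣-square p∣X-1 p∣3E+1)
          (id E X (σ * S N a) (S N w) (progressionSum 3 0 m p))
        where
        id : ∀ E X s s₀ A → + 3 * s - (1ℤ + + 2 * X) ≡
          + 3 * (s - (s₀ - + 6 * E * (A - 1ℤ))) + + 3 * (s₀ - (1ℤ + + 2 * E * (X - 1ℤ))) +
          - (+ 6 * E) * (+ 3 * A - (1ℤ + + 2 * X)) + - (+ 2) * ((X - 1ℤ) * (+ 3 * E + 1ℤ))
        id = solve-∀

      -- In 54 a(a+1) S N a, `root` replaces 9a(a+1) by -2, and `S-third` turns the result into
      -- -4σ(1 + 2X). The boundary term -54(a - N) h m becomes -54(a - N) W, that is 3σP.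
      Σk-f-cong : P * P ∣ + 9 * + a * + suc a + + 2 →
        P * P ∣ + 54 * (+ a - + N) * W + + 3 * σ * P →
        P * P ∣ + 54 * Σ≤ N (λ k → + k * f k a) + σ * (+ 4 - + 3 * P + + 8 * X)
      Σk-f-cong root boundary =
        ∣-combine₄ (+ 54) (- (+ 12)) 1ℤ (- 1ℤ)
          (∣-≡ Σ-reduced)
          (∣-≡ {P * P} {S N a} {σ * (σ * S N a)} (trans (sym (ℤ.*-identityˡ (S N a)))
            (trans (cong (_* S N a) (sym (sgn² m))) (ℤ.*-assoc σ σ (S N a)))))
          (∣-combine₃ (+ 6 * S N a) (- (+ 4 * σ)) (- (+ 54 * (+ a - + N))) root S-third (h-cong m i m<N) refl)
          boundary
          (id P W X σ (S N a) (σ * S N a) (+ a) (+ N) (h m) (Σ≤ N (λ k → + k * f k a)))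
        where
        Σ-reduced : Σ≤ N (λ k → + k * f k a) ≡ + a * + suc a * S N a - (+ a - + N) * h m
        Σ-reduced = linear₂ 1ℤ 1ℤ (Σk-f N a) (f-suc N a)
            (id′ (+ a) (+ N) (Σ≤ N (λ k → + k * f k a)) (S N a) (f N a) (f (suc N) a))
          where
          id′ : ∀ a n w s x y → w - (a * (1ℤ + a) * s - (a - n) * ((1ℤ + (a + n)) * x)) ≡
            1ℤ * (w - (a * (1ℤ + a) * s + (1ℤ + n) * (1ℤ + n) * y)) +
            1ℤ * ((1ℤ + n) * (1ℤ + n) * y - - ((a - n) * (1ℤ + (a + n)) * x))
          id′ = solve-∀
        id : ∀ P W X σ s σs a n h t → + 54 * t + σ * (+ 4 - + 3 * P + + 8 * X) ≡
          + 54 * (t - (a * (1ℤ + a) * s - (a - n) * h)) + - (+ 12) * (s - σ * σs) +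
          1ℤ * (+ 6 * s * (+ 9 * a * (1ℤ + a) + + 2) + - (+ 4 * σ) * (+ 3 * σs - (1ℤ + + 2 * X)) +
                - (+ 54 * (a - n)) * (h - W)) +
          - 1ℤ * (+ 54 * (a - n) * W + + 3 * σ * P)
        id = solve-∀

-- Congruences between rationals

coprime-* : ∀ m n {k} → ℕ.Coprime m k → ℕ.Coprime n k → ℕ.Coprime (m ℕ.* n) k
coprime-* m n {k} m⊥k n⊥k {d} (d∣mn , d∣k) =
  n⊥k (ℕ.coprime-divisor {d} {m} {n} (λ (e∣d , e∣m) → m⊥k (e∣m , ℕ.∣-trans e∣d d∣k)) d∣mn , d∣k)

coprime-^ : ∀ m n {k} → ℕ.Coprime m k → ℕ.Coprime (m ^ n) k
coprime-^ m zero m⊥k = ℕ.1-coprimeTo _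
coprime-^ m (suc n) m⊥k = coprime-* m (m ^ n) m⊥k (coprime-^ m n m⊥k)

fromℚᵘ-+ : ∀ x y → ℚ.fromℚᵘ x ℚ.+ ℚ.fromℚᵘ y ≡ ℚ.fromℚᵘ (x ℚᵘ.+ y)
fromℚᵘ-+ x y = ℚ.toℚᵘ-injective
  (ℚᵘ.≃-trans (ℚ.toℚᵘ-homo-+ (ℚ.fromℚᵘ x) (ℚ.fromℚᵘ y))
  (ℚᵘ.≃-trans (ℚᵘ.+-cong (ℚ.toℚᵘ-fromℚᵘ x) (ℚ.toℚᵘ-fromℚᵘ y))
              (ℚᵘ.≃-sym (ℚ.toℚᵘ-fromℚᵘ (x ℚᵘ.+ y)))))

fromℚᵘ-neg : ∀ x → ℚ.- ℚ.fromℚᵘ x ≡ ℚ.fromℚᵘ (ℚᵘ.- x)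
fromℚᵘ-neg x = ℚ.toℚᵘ-injective
  (ℚᵘ.≃-trans (ℚ.toℚᵘ-homo‿- (ℚ.fromℚᵘ x))
  (ℚᵘ.≃-trans (ℚᵘ.-‿cong (ℚ.toℚᵘ-fromℚᵘ x))
              (ℚᵘ.≃-sym (ℚ.toℚᵘ-fromℚᵘ (ℚᵘ.- x)))))

telescope : ∀ a b c → (a ℚ.- b) ℚ.+ (b ℚ.- c) ≡ a ℚ.- c
telescope a b c =
  trans (ℚ.+-assoc a (ℚ.- b) (b ℚ.- c))
  (cong (a ℚ.+_) (trans (sym (ℚ.+-assoc (ℚ.- b) b (ℚ.- c)))
    (trans (cong (ℚ._- c) (ℚ.+-inverseˡ b)) (ℚ.+-identityˡ (ℚ.- c)))))

interchange : ∀ a b c d → (a ℚ.- b) ℚ.+ (c ℚ.- d) ≡ (a ℚ.+ c) ℚ.- (b ℚ.+ d)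
interchange a b c d =
  trans (ℚ.+-assoc a (ℚ.- b) (c ℚ.- d))
  (trans (cong (a ℚ.+_) (trans (sym (ℚ.+-assoc (ℚ.- b) c (ℚ.- d)))
    (trans (cong (ℚ._- d) (ℚ.+-comm (ℚ.- b) c)) (ℚ.+-assoc c (ℚ.- b) (ℚ.- d)))))
  (trans (sym (ℚ.+-assoc a c (ℚ.- b ℚ.- d))) (cong (λ x → (a ℚ.+ c) ℚ.+ x) (⁻¹-∙-comm b d))))

module RationalCongruence (p m : ℕ) where

  -- `CongModQ p m a b` is definitionally `Multiple (a ℚ.- b)`, so transitivity and addition of
  -- congruences both reduce to `Multiple-+`.
  Multiple : ℚ → Set
  Multiple x = ∃ λ (z : ℤ) → ∃ λ (d : ℕ) → ℕ.Coprime (suc d) p × (x ≡ (+ m * z) ℚ./ suc d)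

  Multiple-+ : ∀ {x y} → Multiple x → Multiple y → Multiple (x ℚ.+ y)
  Multiple-+ (z₁ , d₁ , d₁⊥p , eq₁) (z₂ , d₂ , d₂⊥p , eq₂) =
    -- The second component is the predecessor of suc d₁ * suc d₂.
    z₁ * + suc d₂ + z₂ * + suc d₁ , d₂ ℕ.+ d₁ ℕ.* suc d₂ , coprime-* (suc d₁) (suc d₂) d₁⊥p d₂⊥p ,
    trans (cong₂ ℚ._+_ eq₁ eq₂)
      (trans (fromℚᵘ-+ (mkℚᵘ (+ m * z₁) d₁) (mkℚᵘ (+ m * z₂) d₂))
        (cong (ℚ._/ (suc d₁ ℕ.* suc d₂)) (factor (+ m) z₁ z₂ (+ suc d₁) (+ suc d₂))))
    where
    factor : ∀ m z₁ z₂ d₁ d₂ → m * z₁ * d₂ + m * z₂ * d₁ ≡ m * (z₁ * d₂ + z₂ * d₁)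
    factor = solve-∀

  CongModQ-trans : ∀ a b c → CongModQ p m a b → CongModQ p m b c → CongModQ p m a c
  CongModQ-trans a b c a≡b b≡c = subst Multiple (telescope a b c) (Multiple-+ a≡b b≡c)

  CongModQ-+ : ∀ a b c d → CongModQ p m a b → CongModQ p m c d → CongModQ p m (a ℚ.+ c) (b ℚ.+ d)
  CongModQ-+ a b c d a≡b c≡d = subst Multiple (interchange a b c d) (Multiple-+ a≡b c≡d)

  fraction-cong : ∀ D .{{_ : NonZero D}} i j → ℕ.Coprime D p → + m ∣ i - + D * j →
    CongModQ p m (i ℚ./ D) (j ℚ./ 1)
  fraction-cong (suc d) i j D⊥p (divides z eq) = z , d , D⊥p ,
    trans (cong (λ x → i ℚ./ suc d ℚ.+ x) (fromℚᵘ-neg (mkℚᵘ j 0)))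
    (trans (fromℚᵘ-+ (mkℚᵘ i d) (mkℚᵘ (- j) 0))
      (ℚ./-cong (trans (id i (+ suc d) j) (trans eq (ℤ.*-comm z (+ m)))) (ℕ.*-identityʳ (suc d))))
    where
    id : ∀ i D j → i * 1ℤ + - j * D ≡ i - D * j
    id = solve-∀

  integer-cong : ∀ D .{{_ : NonZero D}} i j → ℕ.Coprime D p → + m ∣ + D * j + i →
    CongModQ p m (j ℚ./ 1) (ℚ.- (i ℚ./ D))
  integer-cong (suc d) i j D⊥p (divides z eq) = z , d , D⊥p ,
    trans (cong (λ x → j ℚ./ 1 ℚ.+ x) (⁻¹-involutive (i ℚ./ suc d)))
    (trans (fromℚᵘ-+ (mkℚᵘ j 0) (mkℚᵘ i d))
      (ℚ./-cong (trans (id i (+ suc d) j) (trans eq (ℤ.*-comm z (+ m)))) (ℕ.*-identityˡ (suc d))))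
    where
    id : ∀ i D j → j * D + i * 1ℤ ≡ D * j + i
    id = solve-∀

  sumTo-cong : ∀ n (g : ℕ → ℚ) (h : ℕ → ℤ) → (∀ k → k ℕ.≤ n → CongModQ p m (g k) (h k ℚ./ 1)) →
    CongModQ p m (sumTo n g) (Σ≤ n h ℚ./ 1)
  sumTo-cong zero g h g≡h = g≡h 0 ℕ.≤-refl
  sumTo-cong (suc n) g h g≡h = subst (CongModQ p m (sumTo (suc n) g))
    (trans (fromℚᵘ-+ (mkℚᵘ (Σ≤ n h) 0) (mkℚᵘ (h (suc n)) 0))
      (cong (ℚ._/ 1) (cong₂ _+_ (ℤ.*-identityʳ (Σ≤ n h)) (ℤ.*-identityʳ (h (suc n))))))
    (CongModQ-+ (sumTo n g) (Σ≤ n h ℚ./ 1) (g (suc n)) (h (suc n) ℚ./ 1)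
      (sumTo-cong n g h (λ k k≤n → g≡h k (ℕ.≤-trans k≤n (ℕ.n≤1+n n)))) (g≡h (suc n) ℕ.≤-refl))

-- The summands modulo p²

-- Written with k * 2, since `suc k ℕ.* 2` computes to two successors of `k ℕ.* 2`; likewise for
-- `ternary`.
central : ℕ → ℤ
central k = binom (k ℕ.* 2) k

central-suc : ∀ k → + suc k * central (suc k) ≡ + 2 * (1ℤ + + 2 * + k) * central k
central-suc k =
  linear₃ 1ℤ (+ 2) (+ 2 * central k - binom (suc (k ℕ.* 2)) k)
    (absorb (1 ℕ.+ k ℕ.* 2) k) (absorb-upper (k ℕ.* 2) k) (pos-* k 2)
    (id (+ k) (+ (k ℕ.* 2)) (central k) (binom (suc (k ℕ.* 2)) k) (central (suc k)))
  where
  id : ∀ k k₂ x y z → (1ℤ + k) * z - + 2 * (1ℤ + + 2 * k) * x ≡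
    1ℤ * ((1ℤ + k) * z - (+ 2 + k₂) * y) + + 2 * ((1ℤ + k₂ - k) * y - (1ℤ + k₂) * x) +
    (+ 2 * x - y) * (k₂ - k * + 2)
  id = solve-∀

ternary : ℕ → ℤ
ternary k = binom (k ℕ.* 3) k

ternary-suc : ∀ k → + 2 * (1ℤ + + 2 * + k) * (+ suc k * ternary (suc k)) ≡
                    + 3 * (+ 2 + + 3 * + k) * (1ℤ + + 3 * + k) * ternary k
ternary-suc k = linear₃ (+ 2 * (1ℤ + + 2 * + k)) (+ 3 * (1ℤ + + 2 * + k)) (+ 3 * (+ 2 + + 3 * + k))
    (subst (λ k₃ → + suc k * ternary (suc k) ≡ (+ 3 + k₃) * x₂) (pos-* k 3) (absorb (2 ℕ.+ k ℕ.* 3) k))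
    (subst (λ k₃ → (+ 2 + k₃ - + k) * x₂ ≡ (+ 2 + k₃) * x₁) (pos-* k 3) (absorb-upper (1 ℕ.+ k ℕ.* 3) k))
    (subst (λ k₃ → (1ℤ + k₃ - + k) * x₁ ≡ (1ℤ + k₃) * ternary k) (pos-* k 3) (absorb-upper (k ℕ.* 3) k))
    (id (+ k) (ternary k) x₁ x₂ (ternary (suc k)))
  where
  x₁ x₂ : ℤ
  x₁ = binom (1 ℕ.+ k ℕ.* 3) k
  x₂ = binom (2 ℕ.+ k ℕ.* 3) k
  id : ∀ k x x₁ x₂ z → + 2 * (1ℤ + + 2 * k) * ((1ℤ + k) * z) - + 3 * (+ 2 + + 3 * k) * (1ℤ + + 3 * k) * x ≡
    + 2 * (1ℤ + + 2 * k) * ((1ℤ + k) * z - (+ 3 + k * + 3) * x₂) +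
    + 3 * (1ℤ + + 2 * k) * ((+ 2 + k * + 3 - k) * x₂ - (+ 2 + k * + 3) * x₁) +
    + 3 * (+ 2 + + 3 * k) * ((1ℤ + k * + 3 - k) * x₁ - (1ℤ + k * + 3) * x)
  id = solve-∀

-- The multinomial coefficient (3k)!/(k!)³.
trinomial : ℕ → ℤ
trinomial k = central k * ternary k

trinomial-suc : ∀ k → + suc k * + suc k * trinomial (suc k) ≡
                      + 3 * (+ 2 + + 3 * + k) * (1ℤ + + 3 * + k) * trinomial k
trinomial-suc k = linear₂ (+ suc k * ternary (suc k)) (central k) (central-suc k) (ternary-suc k)
    (id (+ k) (central k) (ternary k) (central (suc k)) (ternary (suc k)))
  where
  id : ∀ k c t c′ t′ → (1ℤ + k) * (1ℤ + k) * (c′ * t′) - + 3 * (+ 2 + + 3 * k) * (1ℤ + + 3 * k) * (c * t) ≡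
    (1ℤ + k) * t′ * ((1ℤ + k) * c′ - + 2 * (1ℤ + + 2 * k) * c) +
    c * (+ 2 * (1ℤ + + 2 * k) * ((1ℤ + k) * t′) - + 3 * (+ 2 + + 3 * k) * (1ℤ + + 3 * k) * t)
  id = solve-∀

term-numerator : ∀ k → + (k ℕ.* ((2 ℕ.* k) C k) ℕ.* ((3 ℕ.* k) C k)) ≡ + k * trinomial k
term-numerator k =
  trans (pos-* (k ℕ.* ((2 ℕ.* k) C k)) ((3 ℕ.* k) C k))
  (trans (cong₂ _*_ (pos-* k ((2 ℕ.* k) C k)) refl)
  (trans (cong₂ (λ x y → + k * x * y) (binom-comm 2) (binom-comm 3)) (ℤ.*-assoc (+ k) (central k) (ternary k))))
  where
  binom-comm : ∀ d → + ((d ℕ.* k) C k) ≡ binom (k ℕ.* d) k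
  binom-comm d = trans (cong (λ n → + (n C k)) (ℕ.*-comm d k)) (sym (binom≡C (k ℕ.* d) k))

module _ (N : ℕ) (prime : Prime (suc (N ℕ.+ N))) (a : ℕ) where
  open ModPrimeSquare N prime

  -- The step factors -27(a - k)(a + k + 1) and 3(3k + 2)(3k + 1) differ by -3(9a(a+1) + 2), a
  -- multiple of p². The recurrences carry (k+1)², whence the two cancellations.
  trinomial-cong : P * P ∣ + 9 * + a * + suc a + + 2 → ∀ k → k ℕ.< p →
    P * P ∣ + (27 ^ k) * f k a - trinomial k
  trinomial-cong root zero _ = ∣-≡ (trans (cong (1ℤ *_) (f-zero a)) (sym (cong₂ _*_ (binom-zero 0) (binom-zero 0))))
  trinomial-cong root (suc k) k< = cancel-unit² {P} {+ suc k} (unit k<) (cancel-unit² {P} {+ suc k} (unit k<)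
      (∣-combine₄ (+ suc k * + suc k * f (suc k) a) (+ 27 * Z) (- 1ℤ) 1ℤ
        (∣-≡ (pos-* 27 (27 ^ k))) (∣-≡ (f-suc k a)) (∣-≡ (trinomial-suc k))
        (∣-combine₂ (+ 3 * (+ 2 + + 3 * + k) * (1ℤ + + 3 * + k)) (- (+ 3 * Z * f k a))
           (trinomial-cong root k (ℕ.<⇒≤ k<)) root refl)
        (id (+ a) (+ k) Z (+ (27 ^ suc k)) (f k a) (f (suc k) a) (trinomial k) (trinomial (suc k)))))
    where
    Z : ℤ
    Z = + (27 ^ k)
    id : ∀ a k z z′ x y t u → (1ℤ + k) * ((1ℤ + k) * (z′ * y - u)) ≡
      ((1ℤ + k) * (1ℤ + k) * y) * (z′ - + 27 * z) +
      + 27 * z * ((1ℤ + k) * (1ℤ + k) * y - - ((a - k) * (1ℤ + (a + k)) * x)) +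
      - 1ℤ * ((1ℤ + k) * (1ℤ + k) * u - + 3 * (+ 2 + + 3 * k) * (1ℤ + + 3 * k) * t) +
      1ℤ * (+ 3 * (+ 2 + + 3 * k) * (1ℤ + + 3 * k) * (z * x - t) + - (+ 3 * z * x) * (+ 9 * a * (1ℤ + a) + + 2))
    id = solve-∀

-- c is the residue of p modulo 3, and a = m + ep satisfies 3a = c p² - c; the two values
-- of c are the roots of c² - 3c + 2, which turns 9a(a+1) + 2 into a multiple of p².
module Reduction (N m i e : ℕ) (c : ℤ) (prime : Prime (suc (N ℕ.+ N)))
         (3<p : 3 ℕ.< suc (N ℕ.+ N)) (m<N : m ℕ.+ suc i ≡ N)
         (3m≡P-c : + 3 * + m ≡ 1ℤ + (+ N + + N) - c)
         (3e≡cP-1 : + 3 * + e ≡ c * (1ℤ + (+ N + + N)) - 1ℤ)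
         (c-root : c * c - + 3 * c + + 2 ≡ 0ℤ) (σ≡3-2c : sgn m ≡ + 3 - + 2 * c)
         (3m<p : m ℕ.* 3 ℕ.< suc (N ℕ.+ N))
         (third-sum : + 3 * progressionSum 3 0 m (suc (N ℕ.+ N)) - two^ (suc (N ℕ.+ N)) ≡ 1ℤ) where

  open ModPrimeSquare N prime using (p; P; module Sums)
  open RationalCongruence p (p ^ 2)

  w a : ℕ
  w = e ℕ.* p
  a = m ℕ.+ w

  W E : ℤ
  W = + w
  E = + e

  W≡EP : W ≡ E * P
  W≡EP = pos-* e p

  p∣3E+1 : P ∣ + 3 * E + 1ℤ
  p∣3E+1 = divides c (linear₁ 1ℤ 3e≡cP-1 (id c P E))
    where
    id : ∀ c P E → + 3 * E + 1ℤ - c * P ≡ 1ℤ * (+ 3 * E - (c * P - 1ℤ))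
    id = solve-∀

  3a≡cPP-c : + 3 * + a ≡ c * P * P - c
  3a≡cPP-c = linear₃ 1ℤ (+ 3) P 3m≡P-c W≡EP 3e≡cP-1 (id c P (+ m) W E)
    where
    id : ∀ c P m W E → + 3 * (m + W) - (c * P * P - c) ≡
      1ℤ * (+ 3 * m - (P - c)) + + 3 * (W - E * P) + P * (+ 3 * E - (c * P - 1ℤ))
    id = solve-∀

  root : P * P ∣ + 9 * + a * + suc a + + 2
  root = ∣-combine₃ (c * c * P * P - + 2 * c * c + + 3 * c) 1ℤ (+ 3 * + a + (c * P * P - c) + + 3)
      ∣-refl (∣-≡ c-root) (∣-≡ 3a≡cPP-c) (id c P (+ a))
    where
    id : ∀ c P a → + 9 * a * (1ℤ + a) + + 2 ≡
      (c * c * P * P - + 2 * c * c + + 3 * c) * (P * P) + 1ℤ * (c * c - + 3 * c + + 2 - 0ℤ) +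
      (+ 3 * a + (c * P * P - c) + + 3) * (+ 3 * a - (c * P * P - c))
    id = solve-∀

  -- Modulo p, 6a is -2c and -6N is 3, and their sum is 3 - 2c.
  p∣6[a-N]-σ : P ∣ + 6 * (+ a - + N) - sgn m
  p∣6[a-N]-σ = ∣-combine₃ (+ 2 * c * P - + 3) (+ 2) (- 1ℤ) ∣-refl (∣-≡ 3a≡cPP-c) (∣-≡ σ≡3-2c)
      (id c (+ N) (+ a) (sgn m))
    where
    id : ∀ c N a σ → + 6 * (a - N) - σ ≡
      (+ 2 * c * (1ℤ + (N + N)) - + 3) * (1ℤ + (N + N)) +
      + 2 * (+ 3 * a - (c * (1ℤ + (N + N)) * (1ℤ + (N + N)) - c)) + - 1ℤ * (σ - (+ 3 - + 2 * c))
    id = solve-∀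

  boundary : P * P ∣ + 54 * (+ a - + N) * W + + 3 * sgn m * P
  boundary = ∣-combine₃ (+ 54 * (+ a - + N)) (+ 18 * (+ a - + N)) (- (+ 3))
      (∣-≡ W≡EP) (∣-square ∣-refl p∣3E+1) (∣-square ∣-refl p∣6[a-N]-σ)
      (id P W E (+ a) (+ N) (sgn m))
    where
    id : ∀ P W E a N σ → + 54 * (a - N) * W + + 3 * σ * P ≡
      + 54 * (a - N) * (W - E * P) + + 18 * (a - N) * (P * (+ 3 * E + 1ℤ)) +
      - (+ 3) * (P * (+ 6 * (a - N) - σ))
    id = solve-∀

  P² : + (p ^ 2) ≡ P * P
  P² = trans (pos-* p (p ℕ.* 1)) (cong (λ x → P * + x) (ℕ.*-identityʳ p))

  Σkf : ℤ
  Σkf = Σ≤ N (λ k → + k * f k a)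

  rhs : ℤ
  rhs = sgn m * (+ 4 - + (3 ℕ.* p) + + (2 ^ (p ℕ.+ 2)))

  2^[p+2] : + (2 ^ (p ℕ.+ 2)) ≡ + 8 * two^ (N ℕ.+ N)
  2^[p+2] = trans (cong (λ n → + (2 ^ n)) (ℕ.+-comm p 2))
    (trans (sym (two^≡ (2 ℕ.+ p)))
    (trans (two^-suc (suc p)) (trans (cong (+ 2 *_) (trans (two^-suc p) (cong (+ 2 *_) (two^-suc (N ℕ.+ N)))))
      (id (two^ (N ℕ.+ N))))))
    where
    id : ∀ x → + 2 * (+ 2 * (+ 2 * x)) ≡ + 8 * x
    id = solve-∀

  54Σ : + (p ^ 2) ∣ + 54 * Σkf + rhs
  54Σ = subst₂ _∣_ (sym P²)
    (cong₂ (λ x y → + 54 * Σkf + sgn m * (+ 4 - x + y)) (sym (pos-* 3 p)) (sym 2^[p+2]))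
    (Sums.Third.Σk-f-cong w E W≡EP m i m<N 3m<p p∣3E+1 third-sum root boundary)

  N<p : N ℕ.< p
  N<p = ℕ.s≤s (ℕ.m≤m+n N N)

  3⊥p : ℕ.Coprime 3 p
  3⊥p = ℕ.sym (ℕ.prime⇒coprime prime 3<p)

  2⊥p : ℕ.Coprime 2 p
  2⊥p = ℕ.sym (ℕ.prime⇒coprime prime (ℕ.<⇒≤ 3<p))

  term-cong : ∀ k → k ℕ.≤ N → CongModQ p (p ^ 2) (term k) ((+ k * f k a) ℚ./ 1)
  term-cong k k≤N = fraction-cong (27 ^ k) {{ℕ.m^n≢0 27 k}}
    (+ (k ℕ.* ((2 ℕ.* k) C k) ℕ.* ((3 ℕ.* k) C k))) (+ k * f k a)
    (coprime-^ 27 k (coprime-^ 3 3 3⊥p))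
    (subst (_∣ + (k ℕ.* ((2 ℕ.* k) C k) ℕ.* ((3 ℕ.* k) C k)) - + (27 ^ k) * (+ k * f k a)) (sym P²)
    (∣-combine₂ 1ℤ (- + k) (∣-≡ (term-numerator k)) (trinomial-cong N prime a root k (ℕ.≤-<-trans k≤N N<p))
      (id (+ (k ℕ.* ((2 ℕ.* k) C k) ℕ.* ((3 ℕ.* k) C k))) (+ k) (+ (27 ^ k)) (f k a) (trinomial k))))
    where
    id : ∀ n k z x t → n - z * (k * x) ≡ 1ℤ * (n - k * t) + - k * (z * x - t)
    id = solve-∀

  congruence : CongModQ p (p ^ 2) (sumTo N term) (ℚ.- (rhs ℚ./ 54))
  congruence = CongModQ-trans (sumTo N term) (Σkf ℚ./ 1) (ℚ.- (rhs ℚ./ 54))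
    (sumTo-cong N term (λ k → + k * f k a) term-cong)
    (integer-cong 54 rhs Σkf (coprime-* 2 27 2⊥p (coprime-^ 3 3 3⊥p)) 54Σ)

-- The two residue classes of p modulo 6

Claim : ℕ → Set
Claim p = CongModQ p (p ^ 2)
    (sumTo ((p ∸ 1) ℕ./ 2) term)
    (ℚ.- ((legendre3 p ℤ.* ((+ 4) ℤ.- (+ (3 ℕ.* p)) ℤ.+ (+ (2 ^ (p ℕ.+ 2))))) ℚ./ 54))

legendre3-1 : ∀ a → a % 3 ≡ 1 → legendre3 a ≡ 1ℤ
legendre3-1 a eq with a % 3
legendre3-1 a refl | _ = refl

legendre3-2 : ∀ a → a % 3 ≡ 2 → legendre3 a ≡ - 1ℤ
legendre3-2 a eq with a % 3
legendre3-2 a refl | _ = refl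

half : ∀ N → (suc (N ℕ.+ N) ∸ 1) ℕ./ 2 ≡ N
half N = trans (cong (ℕ._/ 2) (double N)) (ℕ.m*n/n≡m N 2)
  where
  double : ∀ N → N ℕ.+ N ≡ N ℕ.* 2
  double = ℕ.solve-∀

claim-from : ∀ N σ → σ ≡ legendre3 (suc (N ℕ.+ N)) → let p = suc (N ℕ.+ N) in
  CongModQ p (p ^ 2) (sumTo N term) (ℚ.- ((σ * (+ 4 - + (3 ℕ.* p) + + (2 ^ (p ℕ.+ 2)))) ℚ./ 54)) → Claim p
claim-from N _ refl = subst (λ n → CongModQ p (p ^ 2) (sumTo n term) (ℚ.- (rhs ℚ./ 54))) (sym (half N))
  where
  p : ℕ
  p = suc (N ℕ.+ N)
  rhs : ℤ
  rhs = legendre3 p * (+ 4 - + (3 ℕ.* p) + + (2 ^ (p ℕ.+ 2)))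

-- Here N = 3q, m = e = 2q and c = 1, with m even. The gap N - m = q must be positive, so q = 0 is
-- excluded first.
claim₁ : ∀ q → Prime (1 ℕ.+ q ℕ.* 6) → 3 ℕ.< 1 ℕ.+ q ℕ.* 6 → Claim (1 ℕ.+ q ℕ.* 6)
claim₁ zero _ (ℕ.s≤s ())
claim₁ q@(suc i) pr 3<p = subst Claim (sym (p≡ q)) (claim-from N (sgn (q ℕ.* 2))
    (trans (sgn-double q) (sym (legendre3-1 p′ (trans (cong (_% 3) (p≡1+ q)) (ℕ.[m+kn]%n≡m%n 1 (q ℕ.* 2) 3)))))
    (Reduction.congruence N (q ℕ.* 2) i (q ℕ.* 2) 1ℤ (subst Prime (p≡ q) pr) (subst (3 ℕ.<_) (p≡ q) 3<p) (m<N i)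
      (linear₂ (+ 3) (- + 2) (pos-* q 2) (pos-* q 3) (id₁ (+ q) (+ (q ℕ.* 2)) (+ N)))
      (linear₂ (+ 3) (- + 2) (pos-* q 2) (pos-* q 3) (id₂ (+ q) (+ (q ℕ.* 2)) (+ N)))
      refl (sgn-double q) (ℕ.s≤s (ℕ.≤-reflexive (3m≡ q)))
      (subst (λ n → + 3 * progressionSum 3 0 (q ℕ.* 2) n - two^ n ≡ 1ℤ) (p≡ q) (third-sum₁ q))))
  where
  N p′ : ℕ
  N = q ℕ.* 3
  p′ = suc (N ℕ.+ N)
  p≡ : ∀ q → 1 ℕ.+ q ℕ.* 6 ≡ suc (q ℕ.* 3 ℕ.+ q ℕ.* 3)
  p≡ = ℕ.solve-∀
  p≡1+ : ∀ q → suc (q ℕ.* 3 ℕ.+ q ℕ.* 3) ≡ 1 ℕ.+ q ℕ.* 2 ℕ.* 3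
  p≡1+ = ℕ.solve-∀
  m<N : ∀ i → suc i ℕ.* 2 ℕ.+ suc i ≡ suc i ℕ.* 3
  m<N = ℕ.solve-∀
  3m≡ : ∀ q → q ℕ.* 2 ℕ.* 3 ≡ q ℕ.* 3 ℕ.+ q ℕ.* 3
  3m≡ = ℕ.solve-∀
  id₁ : ∀ q m N → + 3 * m - (1ℤ + (N + N) - 1ℤ) ≡ + 3 * (m - q * + 2) + - + 2 * (N - q * + 3)
  id₁ = solve-∀
  id₂ : ∀ q m N → + 3 * m - (1ℤ * (1ℤ + (N + N)) - 1ℤ) ≡ + 3 * (m - q * + 2) + - + 2 * (N - q * + 3)
  id₂ = solve-∀

-- Here N = 3q + 2, m = 2q + 1, e = 4q + 3 and c = 2, with m odd and N - m = q + 1.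
claim₅ : ∀ q → Prime (5 ℕ.+ q ℕ.* 6) → 3 ℕ.< 5 ℕ.+ q ℕ.* 6 → Claim (5 ℕ.+ q ℕ.* 6)
claim₅ q pr 3<p = subst Claim (sym (p≡ q)) (claim-from N (sgn (1 ℕ.+ q ℕ.* 2))
    (trans (cong -_ (sgn-double q)) (sym (legendre3-2 p′ (trans (cong (_% 3) (p≡2+ q)) (ℕ.[m+kn]%n≡m%n 2 (1 ℕ.+ q ℕ.* 2) 3)))))
    (Reduction.congruence N (1 ℕ.+ q ℕ.* 2) q (3 ℕ.+ q ℕ.* 4) (+ 2) (subst Prime (p≡ q) pr) (subst (3 ℕ.<_) (p≡ q) 3<p) (m<N q)
      (linear₂ (+ 3) (- + 2) (pos-* q 2) (pos-* q 3) (id₁ (+ q) (+ (q ℕ.* 2)) (+ (q ℕ.* 3))))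
      (linear₂ (+ 3) (- + 4) (pos-* q 4) (pos-* q 3) (id₂ (+ q) (+ (q ℕ.* 4)) (+ (q ℕ.* 3))))
      refl (cong -_ (sgn-double q)) (ℕ.≤-trans (ℕ.≤-reflexive (1+3m≡ q)) (ℕ.n≤1+n _))
      (subst (λ n → + 3 * progressionSum 3 0 (1 ℕ.+ q ℕ.* 2) n - two^ n ≡ 1ℤ) (p≡ q) (third-sum₅ q))))
  where
  N p′ : ℕ
  N = 2 ℕ.+ q ℕ.* 3
  p′ = suc (N ℕ.+ N)
  p≡ : ∀ q → 5 ℕ.+ q ℕ.* 6 ≡ suc (2 ℕ.+ q ℕ.* 3 ℕ.+ (2 ℕ.+ q ℕ.* 3))
  p≡ = ℕ.solve-∀
  p≡2+ : ∀ q → suc (2 ℕ.+ q ℕ.* 3 ℕ.+ (2 ℕ.+ q ℕ.* 3)) ≡ 2 ℕ.+ (1 ℕ.+ q ℕ.* 2) ℕ.* 3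
  p≡2+ = ℕ.solve-∀
  m<N : ∀ q → 1 ℕ.+ q ℕ.* 2 ℕ.+ suc q ≡ 2 ℕ.+ q ℕ.* 3
  m<N = ℕ.solve-∀
  1+3m≡ : ∀ q → suc ((1 ℕ.+ q ℕ.* 2) ℕ.* 3) ≡ 2 ℕ.+ q ℕ.* 3 ℕ.+ (2 ℕ.+ q ℕ.* 3)
  1+3m≡ = ℕ.solve-∀
  id₁ : ∀ q m N → + 3 * (1ℤ + m) - (1ℤ + ((+ 2 + N) + (+ 2 + N)) - + 2) ≡ + 3 * (m - q * + 2) + - + 2 * (N - q * + 3)
  id₁ = solve-∀
  id₂ : ∀ q e N → + 3 * (+ 3 + e) - (+ 2 * (1ℤ + ((+ 2 + N) + (+ 2 + N))) - 1ℤ) ≡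
    + 3 * (e - q * + 4) + - + 4 * (N - q * + 3)
  id₂ = solve-∀

proper-divisor-absurd : ∀ {p d} → Prime p → 1 ℕ.< d → d ℕ.< p → d ℕ.∣ p → ⊥
proper-divisor-absurd pr 1<d d<p d∣p with prime⇒irreducible pr d∣p
... | inj₁ refl = ℕ.<-irrefl refl 1<d
... | inj₂ refl = ℕ.<-irrefl refl d<p

theorem3p5 : (p : ℕ) → Prime p → p > 3 →
    CongModQ p (p ^ 2)
    (sumTo ((p ∸ 1) ℕ./ 2) term)
    (ℚ.- ((legendre3 p ℤ.* ((+ 4) ℤ.- (+ (3 ℕ.* p)) ℤ.+ (+ (2 ^ (p ℕ.+ 2))))) ℚ./ 54))
-- Residues 0, 2 and 4 give the divisor 2 and residue 3 the divisor 3, both proper as p > 3.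
theorem3p5 p pr p>3 with p ℕ.divMod 6
... | ℕ.result q 0F refl = ⊥-elim (proper-divisor-absurd pr (ℕ.s≤s (ℕ.s≤s ℕ.z≤n)) (ℕ.<⇒≤ p>3) (ℕ.divides (q ℕ.* 3) (sym (ℕ.*-assoc q 3 2))))
... | ℕ.result q 1F refl = claim₁ q pr p>3
... | ℕ.result q 2F refl = ⊥-elim (proper-divisor-absurd pr (ℕ.s≤s (ℕ.s≤s ℕ.z≤n)) (ℕ.<⇒≤ p>3) (ℕ.divides (1 ℕ.+ q ℕ.* 3) (cong (2 ℕ.+_) (sym (ℕ.*-assoc q 3 2)))))
... | ℕ.result q 3F refl = ⊥-elim (proper-divisor-absurd pr (ℕ.s≤s (ℕ.s≤s ℕ.z≤n)) p>3 (ℕ.divides (1 ℕ.+ q ℕ.* 2) (cong (3 ℕ.+_) (sym (ℕ.*-assoc q 2 3)))))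
... | ℕ.result q 4F refl = ⊥-elim (proper-divisor-absurd pr (ℕ.s≤s (ℕ.s≤s ℕ.z≤n)) (ℕ.<⇒≤ p>3) (ℕ.divides (2 ℕ.+ q ℕ.* 3) (cong (4 ℕ.+_) (sym (ℕ.*-assoc q 3 2)))))
... | ℕ.result q 5F refl = claim₅ q pr p>3
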